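{- Let $\ell$ be an integer and $k$ an odd integer with $5 \le k < 2\ell$. Then for every integer $n \ge 3$, $$\mathrm{ex}(n, \mathcal{C}_{2\ell} \cup \{C_k\}) \ge \mathrm{z}(n, \mathcal{C}_{2\ell}) + 1.$$
   Context: Graphs are finite and simple. $C_j$ denotes the cycle of length $j$, and $\mathcal{C}_{2\ell} = \{C_4, C_6, \dots, C_{2\ell}\}$. A graph is $\mathcal{F}$-free if it contains no member of the family $\mathcal{F}$ as a (not necessarily induced) subgraph. $\mathrm{ex}(n,\mathcal{F})$ is the maximum number of edges in an $\mathcal{F}$-free graph on $n$ vertices; $\mathrm{z}(n,\mathcal{F})$ is the maximum number of edges in an $\mathcal{F}$-free bipartite graph on $n$ vertices. -}

module Defs where

open import Data.Empty using (⊥-elim)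
open import Data.Fin using (Fin; toℕ; combine; remQuot; finToFun; funToFin; _<_)
open import Data.Fin.Patterns using (0F; 1F)
open import Data.Fin.Properties using (_≟_; _<?_; any?; all?; finToFun-funToFin; remQuot-combine)
open import Data.List.Base using (List; allFin; cartesianProduct; filter; length; map; upTo)
open import Data.List.Extrema.Nat using (max; v≤max⁺; argmax-sel)
open import Data.List.Membership.Propositional.Properties using (∈-allFin; ∈-filter⁺; ∈-filter⁻; ∈-map⁺; ∈-map⁻)
open import Data.List.Properties using (filter-≐)
open import Data.List.Relation.Unary.All as All using (All)
open import Data.List.Relation.Unary.Any as Any using ()
open import Data.Nat.Base as ℕ using (ℕ; suc; _+_; _*_; _^_; _∸_; _≤_)
open import Data.Nat.Properties as ℕ using (≤-reflexive; n≤0⇒n≡0)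
open import Data.Product using (Σ; ∃; _×_; _,_; proj₂)
open import Data.Sum using (_⊎_; inj₁; inj₂)
open import Function using (_∘_; id)
open import Function.Definitions using (Injective)
open import Level using (Level; 0ℓ; _⊔_) renaming (suc to lsuc)
open import Relation.Binary.Construct.Closure.Symmetric as Sym using (SymClosure; fwd; bwd)
open import Relation.Binary.Core using (Rel)
open import Relation.Binary.Definitions using (Symmetric; Irreflexive) renaming (Decidable to Decidable₂)
open import Relation.Binary.PropositionalEquality using (_≡_; _≢_; _≗_; refl; trans; cong; subst; subst₂) renaming (sym to ≡-sym)
open import Relation.Nullary using (¬_; Dec; yes; no)
open import Relation.Nullary.Decidable using (map′; ¬?; _×-dec_; _⊎-dec_; _→-dec_)
open import Relation.Unary using (Pred; Decidable)

record Graph (n : ℕ) : Set₁ where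
  field
    Adj    : Rel (Fin n) 0ℓ
    sym    : Symmetric Adj
    irrefl : Irreflexive _≡_ Adj
    adj?   : Decidable₂ Adj

open Graph public using (Adj; adj?)

-- An edge is represented by its ordered pair of ends with i < j.
Edge : ∀ {n} → Graph n → Pred (Fin n × Fin n) 0ℓ
Edge G (i , j) = i < j × Adj G i j

edge? : ∀ {n} (G : Graph n) → Decidable (Edge G)
edge? G (i , j) = (i <? j) ×-dec adj? G i j

edges : ∀ {n} → Graph n → List (Fin n × Fin n)
edges {n} G = filter (edge? G) (cartesianProduct (allFin n) (allFin n))

edgeCount : ∀ {n} → Graph n → ℕ
edgeCount G = length (edges G)

simple : ∀ {n} {R : Rel (Fin n) 0ℓ} → Decidable₂ R → Graph n
simple {n} {R} R? = record
  { Adj    = λ i j → i ≢ j × SymClosure R i j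
  ; sym    = λ (i≢j , e) → (i≢j ∘ ≡-sym) , Sym.symmetric R e
  ; irrefl = λ i≡j (i≢j , _) → i≢j i≡j
  ; adj?   = λ i j → ¬? (i ≟ j) ×-dec
      map′ (λ { (inj₁ e) → fwd e ; (inj₂ e) → bwd e })
           (λ { (fwd e) → inj₁ e ; (bwd e) → inj₂ e })
           (R? i j ⊎-dec R? j i)
  }

-- The successor relation of the cyclic order 0 → 1 → ⋯ → j - 1 → 0.
Next : ∀ {j} → Rel (Fin j) 0ℓ
Next {j} a b = suc (toℕ a) ≡ toℕ b ⊎ (suc (toℕ a) ≡ j × toℕ b ≡ 0)

next? : ∀ {j} → Decidable₂ (Next {j})
next? {j} a b = (suc (toℕ a) ℕ.≟ toℕ b) ⊎-dec ((suc (toℕ a) ℕ.≟ j) ×-dec (toℕ b ℕ.≟ 0))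

-- A cycle of length j only for j ≥ 3.
C : (j : ℕ) → Graph j
C j = simple next?

-- Not necessarily induced: non-edges of H may map to edges of G.
_⊑_ : ∀ {m n} → Graph m → Graph n → Set
_⊑_ {m} {n} H G = Σ (Fin m → Fin n) λ f →
  Injective _≡_ _≡_ f × (∀ a b → Adj H a b → Adj G (f a) (f b))

Family : Set₁
Family = List (∃ Graph)

Free : ∀ {n} → Family → Graph n → Set₁
Free F G = All (λ (_ , H) → ¬ (H ⊑ G)) F

Bipartite : ∀ {n} → Graph n → Set
Bipartite {n} G = Σ (Fin n → Fin 2) λ side →
  ∀ i j → Adj G i j → side i ≢ side j

-- The family {C 4, C 6, …, C (2 * ℓ)}.
evenCycles : ℕ → Family
evenCycles ℓ = map (λ i → _ , C (4 + 2 * i)) (upTo (ℓ ∸ 1))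

any→? : ∀ {m n} {P : Pred (Fin m → Fin n) 0ℓ} →
        (∀ {f g} → f ≗ g → P f → P g) → Decidable P → Dec (∃ P)
any→? resp P? = map′
  (λ (c , p) → finToFun c , p)
  (λ (f , p) → funToFin f , resp (λ i → ≡-sym (finToFun-funToFin f i)) p)
  (any? (P? ∘ finToFun))

_⊑?_ : ∀ {m n} (H : Graph m) (G : Graph n) → Dec (H ⊑ G)
H ⊑? G = any→?
  (λ {f} {g} f≗g (inj , hom) →
      (λ {a} {b} e → inj (trans (f≗g a) (trans e (≡-sym (f≗g b)))))
    , (λ a b e → subst₂ (Adj G) (f≗g a) (f≗g b) (hom a b e)))
  (λ f → map′ (λ h {a} {b} → h a b) (λ h a b → h {a} {b})
           (all? λ a → all? λ b → (f a ≟ f b) →-dec (a ≟ b))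
         ×-dec
         (all? λ a → all? λ b → adj? H a b →-dec adj? G (f a) (f b)))

free? : ∀ {n} (F : Family) → Decidable (Free {n} F)
free? F G = All.all? (λ (_ , H) → ¬? (H ⊑? G)) F

bipartite? : ∀ {n} → Decidable (Bipartite {n})
bipartite? G = any→?
  (λ f≗g h i j e eq → h i j e (trans (f≗g i) (trans eq (≡-sym (f≗g j)))))
  (λ f → all? λ i → all? λ j → adj? G i j →-dec ¬? (f i ≟ f j))

-- All graphs on Fin n (with repetitions, and up to _≈_), decoded from n × n matrices over Fin 2.
decode : ∀ {n} → Fin (2 ^ (n * n)) → Graph n
decode c = simple λ i j → finToFun c (combine i j) ≟ 1F

graphs : ∀ n → List (Graph n)
graphs n = map decode (allFin (2 ^ (n * n)))

-- The largest number of edges of a graph on n vertices satisfying P;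
-- 0 if there is none (this does not happen for families of cycles C j with j ≥ 3, as
-- the edgeless graph avoids them).  See maxEdges-upper and
-- maxEdges-attained below.
maxEdges : ∀ {p n} {P : Pred (Graph n) p} → Decidable P → ℕ
maxEdges {n = n} P? = max 0 (map edgeCount (filter P? (graphs n)))

ex : ℕ → Family → ℕ
ex n F = maxEdges {n = n} (free? F)

z : ℕ → Family → ℕ
z n F = maxEdges {n = n} (λ G → free? F G ×-dec bipartite? G)

record _≈_ {n} (G H : Graph n) : Set where
  constructor equiv
  field
    to   : ∀ {i j} → Adj G i j → Adj H i j
    from : ∀ {i j} → Adj H i j → Adj G i j

Invariant : ∀ {p n} → Pred (Graph n) p → Set (lsuc 0ℓ ⊔ p)
Invariant P = ∀ {G H} → G ≈ H → P G → P H

edgeCount-≈ : ∀ {n} {G H : Graph n} → G ≈ H → edgeCount G ≡ edgeCount H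
edgeCount-≈ {n} {G} {H} (equiv to from) = cong length (filter-≐ (edge? G) (edge? H)
  ((λ (l , e) → l , to e) , (λ (l , e) → l , from e))
  (cartesianProduct (allFin n) (allFin n)))

free-invariant : ∀ {n} F → Invariant (Free {n} F)
free-invariant F (equiv to from) = All.map
  λ H⋢G (f , inj , hom) → H⋢G (f , inj , λ a b e → from (hom a b e))

bipartite-invariant : ∀ {n} → Invariant (Bipartite {n})
bipartite-invariant (equiv to from) (side , h) = side , λ i j e → h i j (from e)

bit : {A : Set} → Dec A → Fin 2
bit (yes _) = 1F
bit (no  _) = 0F

encode : ∀ {n} → Graph n → Fin (2 ^ (n * n))
encode {n} G = funToFin (λ k → let (i , j) = remQuot n k in bit (adj? G i j))

decode-encode : ∀ {n} (G : Graph n) → G ≈ decode (encode G)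
decode-encode {n} G = equiv to from
  where
  entry : ∀ i j → finToFun (encode G) (combine i j) ≡ bit (adj? G i j)
  entry i j = trans (finToFun-funToFin _ (combine i j))
    (cong (λ (i , j) → bit (adj? G i j)) (remQuot-combine i j))

  entry⁺ : ∀ i j → Adj G i j → finToFun (encode G) (combine i j) ≡ 1F
  entry⁺ i j e with adj? G i j | entry i j
  ... | yes _ | eq = eq
  ... | no ¬e | _  = ⊥-elim (¬e e)

  entry⁻ : ∀ i j → finToFun (encode G) (combine i j) ≡ 1F → Adj G i j
  entry⁻ i j eq with adj? G i j | entry i j
  ... | yes e | _   = e
  ... | no _  | eq′ with () ← trans (≡-sym eq) eq′

  to : ∀ {i j} → Adj G i j → Adj (decode (encode G)) i j
  to {i} {j} e = (λ i≡j → Graph.irrefl G i≡j e) , fwd (entry⁺ i j e)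

  from : ∀ {i j} → Adj (decode (encode G)) i j → Adj G i j
  from {i} {j} (_ , fwd eq) = entry⁻ i j eq
  from {i} {j} (_ , bwd eq) = Graph.sym G (entry⁻ j i eq)

module _ {p : Level} {n : ℕ} {P : Pred (Graph n) p} (P? : Decidable P) (inv : Invariant P) where

  maxEdges-upper : ∀ G → P G → edgeCount G ≤ maxEdges P?
  maxEdges-upper G PG = v≤max⁺ 0 _ (inj₂ (Any.map (λ { refl → ≤-reflexive (edgeCount-≈ G≈G′) })
    (∈-map⁺ edgeCount (∈-filter⁺ P? (∈-map⁺ decode (∈-allFin (encode G))) (inv G≈G′ PG)))))
    where G≈G′ = decode-encode G

  maxEdges-attained : ∃ P → ∃ λ G → P G × edgeCount G ≡ maxEdges P?
  maxEdges-attained (G₀ , PG₀)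
    with argmax-sel id 0 (map edgeCount (filter P? (graphs n)))
  ... | inj₁ ≡0 = G₀ , PG₀ , trans (n≤0⇒n≡0 (subst (edgeCount G₀ ≤_) ≡0 (maxEdges-upper G₀ PG₀)))
                                   (≡-sym ≡0)
  ... | inj₂ ∈xs with ∈-map⁻ edgeCount ∈xs
  ...   | G , G∈ , eq = G , proj₂ (∈-filter⁻ P? {xs = graphs n} G∈) , ≡-sym eq

ex-upper : ∀ {n} F (G : Graph n) → Free F G → edgeCount G ≤ ex n F
ex-upper F = maxEdges-upper (free? F) (free-invariant F)

ex-attained : ∀ {n} F → ∃ (Free {n} F) → ∃ λ (G : Graph n) → Free F G × edgeCount G ≡ ex n F
ex-attained F = maxEdges-attained (free? F) (free-invariant F)

module _ {n : ℕ} (F : Family) where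
  private
    inv : Invariant {n = n} (λ G → Free F G × Bipartite G)
    inv {G} {H} eq (fr , bi) = free-invariant F {G} {H} eq fr , bipartite-invariant {G = G} {H} eq bi

  z-upper : ∀ (G : Graph n) → Free F G → Bipartite G → edgeCount G ≤ z n F
  z-upper G fr bi = maxEdges-upper (λ G → free? F G ×-dec bipartite? G) inv G (fr , bi)

  z-attained : (∃ λ (G : Graph n) → Free F G × Bipartite G) →
               ∃ λ (G : Graph n) → (Free F G × Bipartite G) × edgeCount G ≡ z n F
  z-attained = maxEdges-attained (λ G → free? F G ×-dec bipartite? G) inv

{-# OPTIONS --safe #-}

-- Let G be an extremal bipartite graph.  If G has a path u - v - w, add the edge uw.  As u and w are
-- on the same side, every new cycle is odd, and a new cycle of length k comes from a path of length
-- k - 1 between u and w in G.  If that path avoids v, it closes through v to a cycle of length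
-- k + 1 ≤ 2ℓ; if it passes through v, then v with the longer of the two pieces gives an even cycle
-- of length between 4 and k - 1.  If G has no path u - v - w, it is a matching and any edge can be
-- added without creating a cycle of length at least 4.

module Submission where

open import Defs
open import Data.Empty using (⊥)
open import Data.Fin.Base using (Fin; toℕ; fromℕ<)
open import Data.Fin.Patterns using (0F; 1F; 2F)
open import Data.Fin.Properties as Fin using (toℕ-fromℕ<; toℕ≤pred[n]; toℕ-injective; any?)
open import Data.List.Base using ([]; _∷_; _++_; [_]; filter; length)
open import Data.List.Membership.Propositional using (_∈_)
open import Data.List.Membership.Propositional.Properties using (∈-allFin; ∈-cartesianProduct⁺)
open import Data.List.Relation.Unary.All using ([]; _∷_)
import Data.List.Relation.Unary.All.Properties as All
open import Data.List.Relation.Unary.Any using (here; there)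
open import Data.Nat.Base using (ℕ; zero; suc; _+_; _*_; _∸_; _≤_; _<_; _≥_; z≤n; s≤s; s≤s⁻¹)
open import Data.Nat.Divisibility using (_∣_; _∤_; divides; _∣0; ∣-refl; ∣m∣n⇒∣m+n; ∣m+n∣m⇒∣n; ∣1⇒≡1; n∣m*n; >⇒∤)
open import Data.Nat.DivMod using (_/_; _%_; _mod_; m%n<n; m≡m%n+[m/n]*n; [m+kn]%n≡m%n; [m+n]%n≡m%n; m<n⇒m%n≡m; n%n≡0)
open import Data.Nat.Properties
open import Data.Product using (Σ; ∃; _×_; _,_; proj₁; proj₂)
open import Data.Sum using (_⊎_; inj₁; inj₂)
open import Function using (_∘_; case_of_)
open import Level using (0ℓ)
open import Relation.Binary.Construct.Closure.Symmetric using (fwd; bwd)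
open import Relation.Binary.Definitions using (tri<; tri≈; tri>)
open import Relation.Binary.PropositionalEquality hiding ([_])
open import Relation.Nullary using (¬_; Dec; yes; no; contradiction)
open import Relation.Nullary.Decidable using (_×-dec_; _⊎-dec_; ¬?)
open import Relation.Unary using (Pred; Decidable; _⊆_)

private variable
  n m : ℕ

-- Comparing the lengths of filtered lists.

length-filter-mono : ∀ {A : Set} {P Q : Pred A 0ℓ} (P? : Decidable P) (Q? : Decidable Q) → P ⊆ Q →
                     ∀ xs → length (filter P? xs) ≤ length (filter Q? xs)
length-filter-mono P? Q? P⊆Q [] = z≤n
length-filter-mono P? Q? P⊆Q (x ∷ xs) with P? x | Q? x
... | yes _ | yes _ = s≤s (length-filter-mono P? Q? P⊆Q xs)
... | yes p | no ¬q = contradiction (P⊆Q p) ¬q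
... | no _  | yes _ = m≤n⇒m≤1+n (length-filter-mono P? Q? P⊆Q xs)
... | no _  | no _  = length-filter-mono P? Q? P⊆Q xs

length-filter-strict : ∀ {A : Set} {P Q : Pred A 0ℓ} (P? : Decidable P) (Q? : Decidable Q) → P ⊆ Q →
                       ∀ {x xs} → x ∈ xs → Q x → ¬ P x →
                       length (filter P? xs) < length (filter Q? xs)
length-filter-strict P? Q? P⊆Q {x} {_ ∷ xs} (here refl) q ¬p with P? x | Q? x
... | yes p | _     = contradiction p ¬p
... | no _  | yes _ = s≤s (length-filter-mono P? Q? P⊆Q xs)
... | no _  | no ¬q = contradiction q ¬q
length-filter-strict P? Q? P⊆Q {x} {y ∷ xs} (there x∈xs) q ¬p with P? y | Q? y
... | yes _ | yes _  = s≤s (length-filter-strict P? Q? P⊆Q x∈xs q ¬p)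
... | yes p | no ¬q′ = contradiction (P⊆Q p) ¬q′
... | no _  | yes _  = m≤n⇒m≤1+n (length-filter-strict P? Q? P⊆Q x∈xs q ¬p)
... | no _  | no _   = length-filter-strict P? Q? P⊆Q x∈xs q ¬p

-- Parity and remainders.

even⇒suc-odd : ∀ {i} → 2 ∣ i → 2 ∤ suc i
even⇒suc-odd {i} 2∣i 2∣1+i with () ← ∣1⇒≡1 (∣m+n∣m⇒∣n (subst (2 ∣_) (+-comm 1 i) 2∣1+i) 2∣i)

even⊎suc-even : ∀ i → 2 ∣ i ⊎ 2 ∣ suc i
even⊎suc-even zero = inj₁ (2 ∣0)
even⊎suc-even (suc i) with even⊎suc-even i
... | inj₁ 2∣i   = inj₂ (∣m∣n⇒∣m+n ∣-refl 2∣i)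
... | inj₂ 2∣1+i = inj₁ 2∣1+i

suc-% : ∀ i n → suc i % suc n ≡ suc (i % suc n) % suc n
suc-% i n = trans (cong (λ x → suc x % suc n) (m≡m%n+[m/n]*n i (suc n)))
                  ([m+kn]%n≡m%n (suc (i % suc n)) (i / suc n) (suc n))

-- Both numbers are the common remainder plus a multiple of `suc n`, so `d` is a difference of
-- multiples. This is what separates the positions of an unrolled cycle.
%-≡⇒∣ : ∀ d i n → (d + i) % suc n ≡ i % suc n → suc n ∣ d
%-≡⇒∣ d i n eq = ∣m+n∣m⇒∣n (divides ((d + i) / suc n) (+-cancelˡ-≡ (i % suc n) _ _ sum))
                           (n∣m*n (i / suc n))
  where
  N = suc n
  open ≡-Reasoning
  sum : i % N + (i / N * N + d) ≡ i % N + (d + i) / N * N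
  sum = begin
    i % N + (i / N * N + d)         ≡⟨ +-assoc (i % N) _ d ⟨
    i % N + i / N * N + d           ≡⟨ cong (_+ d) (m≡m%n+[m/n]*n i N) ⟨
    i + d                           ≡⟨ +-comm i d ⟩
    d + i                           ≡⟨ m≡m%n+[m/n]*n (d + i) N ⟩
    (d + i) % N + (d + i) / N * N   ≡⟨ cong (_+ (d + i) / N * N) eq ⟩
    i % N + (d + i) / N * N         ∎

-- Paths, cycles and copies of `C`.

-- Paths and cycles are indexed by ℕ.  A path with m edges uses only the indices up to m.
record IsPath (G : Graph n) (m : ℕ) (p : ℕ → Fin n) : Set where
  field
    step     : ∀ {i} → i < m → Adj G (p i) (p (suc i))
    distinct : ∀ {i j} → i < j → j ≤ m → p i ≢ p j

-- A cycle with suc m edges, as a periodic sequence; this form is invariant under shifting indices.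
record IsCycle (G : Graph n) (m : ℕ) (p : ℕ → Fin n) : Set where
  field
    step     : ∀ i → Adj G (p i) (p (suc i))
    period   : ∀ i → p (suc m + i) ≡ p i
    distinct : ∀ {d} i → 0 < d → d ≤ m → p (d + i) ≢ p i

  path-distinct : ∀ {i j} → i < j → j ≤ m → p i ≢ p j
  path-distinct {i} {j} i<j j≤m eq = distinct i (m<n⇒0<n∸m i<j) (≤-trans (m∸n≤m j i) j≤m)
    (trans (cong p (m∸n+n≡m (<⇒≤ i<j))) (sym eq))

  closing : Adj G (p m) (p 0)
  closing = subst (Adj G (p m)) (trans (cong p (cong suc (sym (+-identityʳ m)))) (period 0)) (step m)

  path : IsPath G m p
  path = record { step = λ {i} _ → step i ; distinct = path-distinct }

close : ∀ (G : Graph n) {p} → IsPath G m p → Adj G (p m) (p 0) → C (suc m) ⊑ G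
close {m = m} G {p} P e = p ∘ toℕ , injective , λ a b → adj
  where
  open IsPath P
  injective : ∀ {a b : Fin (suc m)} → p (toℕ a) ≡ p (toℕ b) → a ≡ b
  injective {a} {b} eq with <-cmp (toℕ a) (toℕ b)
  ... | tri< a<b _ _ = contradiction eq (distinct a<b (toℕ≤pred[n] b))
  ... | tri≈ _ a≡b _ = toℕ-injective a≡b
  ... | tri> _ _ b<a = contradiction (sym eq) (distinct b<a (toℕ≤pred[n] a))

  next : ∀ {a b : Fin (suc m)} → Next a b → Adj G (p (toℕ a)) (p (toℕ b))
  next {a} {b} (inj₁ eq) = subst (Adj G (p (toℕ a)) ∘ p) eq
    (step (subst (_≤ m) (sym eq) (toℕ≤pred[n] b)))
  next (inj₂ (a≡m , b≡0)) = subst₂ (λ a b → Adj G (p a) (p b)) (sym (suc-injective a≡m)) (sym b≡0) e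

  adj : ∀ {a b} → Adj (C (suc m)) a b → Adj G (p (toℕ a)) (p (toℕ b))
  adj (_ , fwd a→b) = next a→b
  adj (_ , bwd b→a) = Graph.sym G (next b→a)

-- Reading indices modulo `suc m` repeats the copy forever, so no position is special and the cycle
-- can later be cut at any chosen edge.
unroll : ∀ (G : Graph n) → 1 ≤ m → C (suc m) ⊑ G → ∃ (IsCycle G m)
unroll {m = m} G 1≤m (f , inj , hom) = f ∘ ι , record
  { step     = λ i → hom (ι i) (ι (suc i))
      -- Adjacency in `C` also demands distinct ends: if they coincided, `suc m`, which is at least
      -- 2, would divide 1.
      ( (λ eq → >⇒∤ (s≤s 1≤m) (%-≡⇒∣ 1 i m (sym (%-eq i (suc i) eq))))
      , fwd (next i))
  ; period   = λ i → cong f (toℕ-injective (trans (toℕ-ι (suc m + i))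
      (trans (trans (cong (_% suc m) (+-comm (suc m) i)) ([m+n]%n≡m%n i (suc m))) (sym (toℕ-ι i)))))
  ; distinct = λ { {suc d} i _ d≤m eq →
      >⇒∤ (s≤s d≤m) (%-≡⇒∣ (suc d) i m (%-eq (suc d + i) i (inj eq))) }
  }
  where
  ι : ℕ → Fin (suc m)
  ι i = i mod suc m

  toℕ-ι : ∀ i → toℕ (ι i) ≡ i % suc m
  toℕ-ι i = toℕ-fromℕ< (m%n<n i (suc m))

  %-eq : ∀ i j → ι i ≡ ι j → i % suc m ≡ j % suc m
  %-eq i j eq = trans (sym (toℕ-ι i)) (trans (cong toℕ eq) (toℕ-ι j))

  next : ∀ i → Next (ι i) (ι (suc i))
  next i rewrite toℕ-ι i | toℕ-ι (suc i) | suc-% i m with m≤n⇒m<n∨m≡n (m%n<n i (suc m))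
  ... | inj₁ lt = inj₁ (sym (m<n⇒m%n≡m lt))
  ... | inj₂ eq = inj₂ (eq , trans (cong (_% suc m) eq) (n%n≡0 (suc m)))

-- Adding an edge.

Joins : Fin n → Fin n → Fin n → Fin n → Set
Joins u w a b = (a ≡ u × b ≡ w) ⊎ (a ≡ w × b ≡ u)

joins? : (u w a b : Fin n) → Dec (Joins u w a b)
joins? u w a b = ((a Fin.≟ u) ×-dec (b Fin.≟ w)) ⊎-dec ((a Fin.≟ w) ×-dec (b Fin.≟ u))

joins-flip : ∀ {u w a b : Fin n} → Joins u w a b → Joins u w b a
joins-flip (inj₁ (a≡u , b≡w)) = inj₂ (b≡w , a≡u)
joins-flip (inj₂ (a≡w , b≡u)) = inj₁ (b≡u , a≡w)

joins-same : ∀ {u w a b c d : Fin n} → Joins u w a b → Joins u w c d → Joins a b c d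
joins-same (inj₁ (refl , refl)) J = J
joins-same (inj₂ (refl , refl)) (inj₁ (c≡u , d≡w)) = inj₂ (c≡u , d≡w)
joins-same (inj₂ (refl , refl)) (inj₂ (c≡w , d≡u)) = inj₁ (c≡w , d≡u)

module _ (G : Graph n) {u w : Fin n} (u≢w : u ≢ w) where

  addEdge : Graph n
  addEdge = record
    { Adj    = λ a b → Adj G a b ⊎ Joins u w a b
    ; sym    = λ { (inj₁ e) → inj₁ (Graph.sym G e) ; (inj₂ J) → inj₂ (joins-flip J) }
    ; irrefl = λ { refl (inj₁ e) → Graph.irrefl G refl e
                 ; refl (inj₂ (inj₁ (a≡u , a≡w))) → u≢w (trans (sym a≡u) a≡w)
                 ; refl (inj₂ (inj₂ (a≡w , a≡u))) → u≢w (trans (sym a≡u) a≡w) }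
    ; adj?   = λ a b → adj? G a b ⊎-dec joins? u w a b
    }

  edgeCount-addEdge : ¬ Adj G u w → edgeCount G < edgeCount addEdge
  -- `edges` lists an edge with its smaller end first, so the order of `u` and `w` decides which
  -- pair is the new entry.
  edgeCount-addEdge ¬uw with Fin.<-cmp u w
  ... | tri< u<w _ _ = length-filter-strict (edge? G) (edge? addEdge) (λ (lt , e) → lt , inj₁ e)
    (∈-cartesianProduct⁺ (∈-allFin u) (∈-allFin w)) (u<w , inj₂ (inj₁ (refl , refl))) (¬uw ∘ proj₂)
  ... | tri≈ _ u≡w _ = contradiction u≡w u≢w
  ... | tri> _ _ w<u = length-filter-strict (edge? G) (edge? addEdge) (λ (lt , e) → lt , inj₁ e)
    (∈-cartesianProduct⁺ (∈-allFin w) (∈-allFin u)) (w<u , inj₂ (inj₂ (refl , refl)))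
    (¬uw ∘ Graph.sym G ∘ proj₂)

  -- The cycle must use the new edge, or it would lie in `G`. Started just after that edge, its next
  -- `m` edges are old, because a cycle of length at least 3 does not traverse the pair `u`, `w`
  -- twice in a period.
  path-of-new-cycle : 2 ≤ m → C (suc m) ⊑ addEdge → ¬ C (suc m) ⊑ G →
                      ∃ λ p → IsPath G m p × Joins u w (p 0) (p m)
  path-of-new-cycle {m} 2≤m C⊑ C⋢ with unroll addEdge (≤-trans (s≤s z≤n) 2≤m) C⊑
  -- The `suc m` indices tried cover a full period, including the closing edge at index `m`.
  ... | p , cyc = case any? {n = suc m} (λ i → joins? u w (p (toℕ i)) (p (suc (toℕ i)))) of λ
    { (yes (a , J)) → rotated (toℕ a) J
    ; (no ¬J) → contradiction (old λ i≤m J → ¬J (fromℕ< (s≤s i≤m) ,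
        subst (λ i → Joins u w (p i) (p (suc i))) (sym (toℕ-fromℕ< (s≤s i≤m))) J)) C⋢
    }
    where
    open IsCycle cyc

    oldEdge : ∀ i → ¬ Joins u w (p i) (p (suc i)) → Adj G (p i) (p (suc i))
    oldEdge i ¬J with step i
    ... | inj₁ e = e
    ... | inj₂ J = contradiction J ¬J

    old : (∀ {i} → i ≤ m → ¬ Joins u w (p i) (p (suc i))) → C (suc m) ⊑ G
    old ¬J = close G (record { step = λ {i} i<m → oldEdge i (¬J (<⇒≤ i<m)) ; distinct = path-distinct })
      (subst (Adj G (p m)) (trans (cong (p ∘ suc) (sym (+-identityʳ m))) (period 0)) (oldEdge m (¬J ≤-refl)))

    rotated : ∀ a → Joins u w (p a) (p (suc a)) → ∃ λ q → IsPath G m q × Joins u w (q 0) (q m)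
    rotated a J = (λ i → p (i + suc a)) , record
      { step     = λ {i} i<m → oldEdge (i + suc a) λ J′ → notAgain i i<m (joins-same J J′)
      ; distinct = λ {i} {j} i<j j≤m eq →
          distinct (i + suc a) (m<n⇒0<n∸m i<j) (≤-trans (m∸n≤m j i) j≤m)
            (trans (cong p (trans (sym (+-assoc (j ∸ i) i (suc a))) (cong (_+ suc a) (m∸n+n≡m (<⇒≤ i<j)))))
                   (sym eq))
      -- The new path starts at `p (suc a)` and ends at `p (suc m + a)`, which is `p a` by
      -- periodicity; the ends come in reverse order, hence the flip.
      } , subst (Joins u w (p (suc a))) (sym (trans (cong p (+-suc m a)) (period a))) (joins-flip J)
      where
      notAgain : ∀ i → i < m → ¬ Joins (p a) (p (suc a)) (p (i + suc a)) (p (suc (i + suc a)))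
      notAgain i i<m (inj₁ (eq , _)) = distinct a (s≤s z≤n) i<m (trans (cong p (sym (+-suc i a))) eq)
      -- Here the equation between first ends is trivially true, so the other one is refuted: it
      -- identifies vertices two steps apart, against `2 ≤ m`.
      notAgain zero i<m (inj₂ (_ , eq)) = distinct a (s≤s z≤n) 2≤m eq
      notAgain (suc i) i<m (inj₂ (eq , _)) = distinct (suc a) (s≤s z≤n) (<⇒≤ i<m) eq

-- Parity along paths in bipartite graphs.

Fin2-≢-≢ : ∀ {a b c : Fin 2} → a ≢ b → b ≢ c → a ≡ c
Fin2-≢-≢ {0F} {0F}      a≢b _   = contradiction refl a≢b
Fin2-≢-≢ {0F} {1F} {0F} _   _   = refl
Fin2-≢-≢ {0F} {1F} {1F} _   b≢c = contradiction refl b≢c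
Fin2-≢-≢ {1F} {0F} {0F} _   b≢c = contradiction refl b≢c
Fin2-≢-≢ {1F} {0F} {1F} _   _   = refl
Fin2-≢-≢ {1F} {1F}      a≢b _   = contradiction refl a≢b

module _ (G : Graph n) (bip : Bipartite G) where
  private
    side   = proj₁ bip
    proper = proj₂ bip

  -- Each step flips both the side and the parity of the index. Oddness is recorded as `2 ∣ suc i`
  -- because `suc i` is the length of the cycle obtained by closing the path at `p i`.
  sides-alternate : ∀ {p} → IsPath G m p → ∀ i → i ≤ m →
    (2 ∣ i × side (p i) ≡ side (p 0)) ⊎ (2 ∣ suc i × side (p i) ≢ side (p 0))
  sides-alternate P zero _ = inj₁ (2 ∣0 , refl)
  sides-alternate P (suc i) i<m with sides-alternate P i (<⇒≤ i<m) | proper _ _ (IsPath.step P i<m)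
  ... | inj₁ (2∣i , same)     | pᵢ≢ = inj₂ (∣m∣n⇒∣m+n ∣-refl 2∣i , λ eq → pᵢ≢ (trans same (sym eq)))
  ... | inj₂ (2∣1+i , differ) | pᵢ≢ = inj₁ (2∣1+i , Fin2-≢-≢ (pᵢ≢ ∘ sym) differ)

  -- Both ends lie on the side opposite `v`, which excludes the odd case.
  common-neighbour⇒even : ∀ {p i v} → IsPath G m p → i ≤ m → Adj G v (p 0) → Adj G v (p i) → 2 ∣ i
  common-neighbour⇒even {i = i} P i≤m vp₀ vpᵢ with sides-alternate P i i≤m
  ... | inj₁ (2∣i , _)    = 2∣i
  ... | inj₂ (_ , differ) =
    contradiction (Fin2-≢-≢ (proper _ _ vpᵢ ∘ sym) (proper _ _ vp₀)) differ

  adjacent⇒odd : ∀ {p i} → IsPath G m p → i ≤ m → Adj G (p i) (p 0) → 2 ∣ suc i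
  adjacent⇒odd {i = i} P i≤m e with sides-alternate P i i≤m
  ... | inj₁ (_ , same)  = contradiction same (proper _ _ e)
  ... | inj₂ (2∣1+i , _) = 2∣1+i

  bipartite⇒no-odd-cycle : 1 ≤ m → 2 ∤ suc m → ¬ C (suc m) ⊑ G
  bipartite⇒no-odd-cycle 1≤m odd C⊑ with unroll G 1≤m C⊑
  ... | p , cyc = odd (adjacent⇒odd (IsCycle.path cyc) ≤-refl (IsCycle.closing cyc))

-- Even cycles and paths between two neighbours of a vertex.

-- Freeness from `evenCycles ℓ` phrased by divisibility, since the cycles found below come with a
-- proof of evenness and not in the form `4 + 2 * i`.
EvenCycleFree : ℕ → Graph n → Set
EvenCycleFree ℓ G = ∀ j → 2 ∣ j → 4 ≤ j → j ≤ 2 * ℓ → ¬ C j ⊑ G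

free⇒evenCycleFree : ∀ ℓ (G : Graph n) → Free (evenCycles ℓ) G → EvenCycleFree ℓ G
free⇒evenCycleFree ℓ G free _ (divides 0 refl) ()
free⇒evenCycleFree ℓ G free _ (divides 1 refl) (s≤s (s≤s ()))
free⇒evenCycleFree ℓ G free _ (divides (suc (suc i)) refl) _ j≤2ℓ =
  subst (λ x → ¬ C (4 + x) ⊑ G) (*-comm 2 i)
    (All.applyUpTo⁻ _ (ℓ ∸ 1) (All.map⁻ free)
      (∸-monoˡ-≤ 1 (*-cancelʳ-≤ (2 + i) ℓ 2 (subst ((2 + i) * 2 ≤_) (*-comm 2 ℓ) j≤2ℓ))))

evenCycleFree⇒free : ∀ ℓ (G : Graph n) → EvenCycleFree ℓ G → Free (evenCycles ℓ) G
evenCycleFree⇒free ℓ G ecf = All.map⁺ (All.applyUpTo⁺₁ _ (ℓ ∸ 1) λ {i} i<ℓ-1 →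
  ecf (4 + 2 * i) (divides (2 + i) (cong (4 +_) (*-comm 2 i))) (m≤m+n 4 _) (bound ℓ i<ℓ-1))
  where
  bound : ∀ ℓ {i} → i < ℓ ∸ 1 → 4 + 2 * i ≤ 2 * ℓ
  bound (suc ℓ) {i} i<ℓ = subst (_≤ 2 * suc ℓ) (*-distribˡ-+ 2 2 i) (*-monoʳ-≤ 2 (s≤s i<ℓ))

prepend : Fin n → (ℕ → Fin n) → ℕ → Fin n
prepend v p zero    = v
prepend v p (suc i) = p i

module _ (G : Graph n) ℓ (bip : Bipartite G) (ecf : EvenCycleFree ℓ G) {p} (P : IsPath G m p) where
  open IsPath P

  -- As `v` is adjacent to both ends, cutting the path at `v` leaves pieces that close to cycles
  -- once they have two edges. The piece before `v` serves unless it is a single edge; then the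
  -- piece after `v`, with `m - 1` edges, closes to an even cycle of length `m`.
  common-neighbour∉path : 4 ≤ m → 2 + m ≤ 2 * ℓ → ∀ {v} → Adj G v (p 0) → Adj G v (p m) →
                          ∀ i → i ≤ m → p i ≢ v
  common-neighbour∉path _ _ vp₀ _ zero _ refl = Graph.irrefl G refl vp₀
  common-neighbour∉path (s≤s {n = m′} 3≤m′) bound vp₀ vpₘ 1 _ refl =
    ecf m (common-neighbour⇒even G bip P ≤-refl vp₀ vpₘ) (s≤s 3≤m′) (≤-trans (m≤n+m m 2) bound)
      (close G {p = p ∘ suc} (record { step = λ i<m′ → step (s≤s i<m′)
                                   ; distinct = λ i<j j≤m′ → distinct (s≤s i<j) (s≤s j≤m′) })
             (Graph.sym G vpₘ))
  common-neighbour∉path 4≤m bound vp₀ vpₘ (suc (suc i)) i+2≤m refl = ecf (3 + i) 2∣3+i (4≤3+ i 2∣3+i)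
    (≤-trans (s≤s i+2≤m) (≤-trans (n≤1+n _) bound))
    (close G (record { step = λ lt → step (≤-trans lt i+2≤m)
                   ; distinct = λ lt le → distinct lt (≤-trans le i+2≤m) }) vp₀)
    where
    2∣3+i : 2 ∣ 3 + i
    2∣3+i = adjacent⇒odd G bip P i+2≤m vp₀
    -- The value `i = 0` would give a triangle, which the evenness of the length excludes.
    4≤3+ : ∀ i → 2 ∣ 3 + i → 4 ≤ 3 + i
    4≤3+ zero    2∣3 = contradiction 2∣3 (even⇒suc-odd {2} ∣-refl)
    4≤3+ (suc _) _   = s≤s (s≤s (s≤s (s≤s z≤n)))

  -- With `v` off the path, going through `v` closes it to a cycle of length `2 + m`, even because
  -- `m` is.
  no-path-between-neighbours : 4 ≤ m → 2 + m ≤ 2 * ℓ → ∀ {v} → Adj G v (p 0) → Adj G v (p m) → ⊥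
  no-path-between-neighbours 4≤m bound {v} vp₀ vpₘ =
    ecf (2 + m) (∣m∣n⇒∣m+n ∣-refl (common-neighbour⇒even G bip P ≤-refl vp₀ vpₘ))
      (≤-trans 4≤m (m≤n+m m 2)) bound
      (close G {p = prepend v p} (record
        { step     = λ { {zero} _ → vp₀ ; {suc i} (s≤s i<m) → step i<m }
        ; distinct = λ { {zero} {suc j} _ (s≤s j≤m) → common-neighbour∉path 4≤m bound vp₀ vpₘ j j≤m ∘ sym
                       ; {suc i} {suc j} (s≤s i<j) (s≤s j≤m) → distinct i<j j≤m } })
        (Graph.sym G vpₘ))

joins-common : ∀ (G : Graph n) {u w v a b} → Adj G v u → Adj G v w → Joins u w a b → Adj G v a × Adj G v b
joins-common _ vu vw (inj₁ (refl , refl)) = vu , vw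
joins-common _ vu vw (inj₂ (refl , refl)) = vw , vu

-- Choosing the edge to add.

Cherry : Graph n → Set
Cherry {n} G = Σ (Fin n) λ v → Σ (Fin n) λ u → Σ (Fin n) λ w → u ≢ w × Adj G v u × Adj G v w

cherry? : (G : Graph n) → Dec (Cherry G)
cherry? G = any? λ v → any? λ u → any? λ w → ¬? (u Fin.≟ w) ×-dec (adj? G v u ×-dec adj? G v w)

path⇒cherry : ∀ {G : Graph n} {p} → 2 ≤ m → IsPath G m p → Cherry G
path⇒cherry {G = G} {p} 2≤m P = p 1 , p 0 , p 2 , distinct (s≤s z≤n) 2≤m ,
  Graph.sym G (step (≤-trans (s≤s z≤n) 2≤m)) , step 2≤m
  where open IsPath P

-- Vertex 0 adjacent to both 1 and 2 would be the centre of a cherry; `3 ≤ n` supplies these three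
-- vertices.
nonEdge : 3 ≤ n → (G : Graph n) → ¬ Cherry G → Σ (Fin n) λ u → Σ (Fin n) λ w → u ≢ w × ¬ Adj G u w
nonEdge (s≤s (s≤s (s≤s _))) G ¬cherry with adj? G 0F 1F | adj? G 0F 2F
... | no ¬e  | _      = 0F , 1F , (λ ()) , ¬e
... | yes _  | no ¬e  = 0F , 2F , (λ ()) , ¬e
... | yes e₁ | yes e₂ = contradiction (0F , 1F , 2F , (λ ()) , e₁ , e₂) ¬cherry

-- Here the odd cycle has length `suc k`, so removing the new edge leaves a path with `k` edges, and
-- `2 + k` is the length of its closure through `v`.
addableEdge : 3 ≤ n → ∀ {ℓ k} → 2 ∤ suc k → 4 ≤ k → 2 + k ≤ 2 * ℓ →
  (G : Graph n) → Bipartite G → EvenCycleFree ℓ G →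
  Σ (Fin n) λ u → Σ (Fin n) λ w → Σ (u ≢ w) λ u≢w →
    ¬ Adj G u w × EvenCycleFree ℓ (addEdge G u≢w) × ¬ C (suc k) ⊑ addEdge G u≢w
addableEdge {n} 3≤n {ℓ} {k} odd 4≤k bound G bip@(side , proper) ecf with cherry? G
... | yes (v , u , w , u≢w , vu , vw) = u , w , u≢w ,
    (λ uw → proper u w uw (Fin2-≢-≢ (proper v u vu ∘ sym) (proper v w vw)))
  -- An even new cycle would leave a path with an odd number `m` of edges between two neighbours of
  -- `v`.
  , (λ { (suc m) 2∣j 4≤j j≤2ℓ C⊑ →
         let p , P , J = path-of-new-cycle G u≢w (≤-trans (s≤s (s≤s z≤n)) (s≤s⁻¹ 4≤j)) C⊑
                           (ecf (suc m) 2∣j 4≤j j≤2ℓ)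
             vp₀ , vpₘ = joins-common G vu vw J
         in even⇒suc-odd (common-neighbour⇒even G bip P ≤-refl vp₀ vpₘ) 2∣j })
  , λ C⊑ →
         let p , P , J = path-of-new-cycle G u≢w (≤-trans (s≤s (s≤s z≤n)) 4≤k) C⊑
                           (bipartite⇒no-odd-cycle G bip (≤-trans (s≤s z≤n) 4≤k) odd)
             vp₀ , vpₘ = joins-common G vu vw J
         in no-path-between-neighbours G ℓ bip ecf P 4≤k bound vp₀ vpₘ
... | no ¬cherry = let u , w , u≢w , ¬uw = nonEdge 3≤n G ¬cherry in u , w , u≢w , ¬uw
  -- Without cherries, `G` has no path with two edges, whereas a new cycle of length at least 4
  -- would leave one.
  , (λ { (suc m) 2∣j 4≤j j≤2ℓ C⊑ →
         let 2≤m = ≤-trans (s≤s (s≤s z≤n)) (s≤s⁻¹ 4≤j)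
             p , P , _ = path-of-new-cycle G u≢w 2≤m C⊑ (ecf (suc m) 2∣j 4≤j j≤2ℓ)
         in ¬cherry (path⇒cherry 2≤m P) })
  , λ C⊑ →
         let 2≤k = ≤-trans (s≤s (s≤s z≤n)) 4≤k
             p , P , _ = path-of-new-cycle G u≢w 2≤k C⊑
                           (bipartite⇒no-odd-cycle G bip (≤-trans (s≤s z≤n) 4≤k) odd)
         in ¬cherry (path⇒cherry 2≤k P)

-- The inequality between the extremal numbers.

edgeless : ∀ n → Graph n
edgeless n = record { Adj = λ _ _ → ⊥ ; sym = λ () ; irrefl = λ _ () ; adj? = λ _ _ → no λ () }

edgeless-evenCycleFree : ∀ n ℓ → EvenCycleFree ℓ (edgeless n)
edgeless-evenCycleFree n ℓ (suc m) _ 4≤j _ C⊑ =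
  IsCycle.step (proj₂ (unroll (edgeless n) (≤-trans (s≤s z≤n) (s≤s⁻¹ 4≤j)) C⊑)) 0

mainTheorem5 : ∀ (ℓ k : ℕ) → 2 ∤ k → 5 ≤ k → k < 2 * ℓ →
    ∀ (n : ℕ) → 3 ≤ n →
    ex n (evenCycles ℓ ++ [ k , C k ]) ≥ z n (evenCycles ℓ) + 1
mainTheorem5 ℓ (suc k) odd (s≤s 4≤k) k<2ℓ n 3≤n
  -- The edgeless graph shows that some graph qualifies, so that `z` is attained by an actual graph
  -- `G`.
  with z-attained {n} (evenCycles ℓ)
         (edgeless n , evenCycleFree⇒free ℓ (edgeless n) (edgeless-evenCycleFree n ℓ)
                     , (λ _ → 0F) , λ _ _ ())
... | G , (free , bip) , count
  -- After the match on `suc k`, the hypothesis `k<2ℓ` unfolds to the required `2 + k ≤ 2 * ℓ`.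
  with addableEdge 3≤n {ℓ} odd 4≤k k<2ℓ G bip (free⇒evenCycleFree ℓ G free)
... | u , w , u≢w , ¬uw , ecf , C⋢ = begin
  z n (evenCycles ℓ) + 1                 ≡⟨ cong (_+ 1) count ⟨
  edgeCount G + 1                        ≡⟨ +-comm (edgeCount G) 1 ⟩
  suc (edgeCount G)                      ≤⟨ edgeCount-addEdge G u≢w ¬uw ⟩
  edgeCount G⁺                           ≤⟨ ex-upper F G⁺ (All.++⁺ (evenCycleFree⇒free ℓ G⁺ ecf) (C⋢ ∷ [])) ⟩
  ex n F                                 ∎
  where
  open ≤-Reasoning
  G⁺ = addEdge G u≢w
  F = evenCycles ℓ ++ [ suc k , C (suc k) ]
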